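{- Let $G=(V,E)$ be a graph with at least two vertices. Let $\mathcal{D}=\{x\in V: d(x)=|V|-2\}$ be the set of quasi-stars of $G$, let $v:\mathcal{D}\to V$ be the map defined by $\{v(x)\}=V\setminus N[x]$, and let $\mathcal{T}=v(\mathcal{D})$ be its image. Then: (a) $\mathcal{T}=\operatorname{ex}(V)$ and $|\mathcal{D}|\geq |\operatorname{ex}(V)|$; (b) $V=N[\mathcal{D}]\cup \operatorname{ex}(V)$ and $N[\mathcal{D}]\cap \operatorname{ex}(V)=\varnothing$; (c) if $G$ is true twins free, then $v$, considered as a map from $\mathcal{D}$ to $\operatorname{ex}(V)$, is a bijection; (d) if $G$ is an $n$-convex geometry, then $|\operatorname{ex}(V)|=|\mathcal{D}|\geq 2$.
   Context: All graphs are finite, simple and undirected, with non-empty vertex set. $d(x)$ denotes the degree of the vertex $x$. For a graph $G=(V,E)$ and $x\in V$, the closed neighbourhood of $x$ is $N[x]=\{x\}\cup\{y\in V:\{x,y\}\in E\}$. $G$ is true twins free if there are no distinct $x,y\in V$ with $N[x]=N[y]$. For $Y\subseteq V$, the common closed neighbourhood is $N[Y]=\bigcap_{y\in Y}N[y]$ if $Y\neq\varnothing$, and $N[\varnothing]=V$. The neighbourhood convexity of $G$ is the family $n_G=\{N[Y]:Y\subseteq V\}\cup\{\varnothing\}$ of subsets of $V$; it contains $\varnothing$ and $V$ and is closed under intersection. Its members are called $n$-convex sets. For $X\subseteq V$ the convex hull $[X]_{n}$ is the intersection of all $n$-convex sets containing $X$. For an $n$-convex set $K$, $\operatorname{ex}(K)=\{x\in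 K: K\setminus\{x\}\in n_G\}$ is the set of extreme points of $K$. $G$ is an $n$-convex geometry if $K=[\operatorname{ex}(K)]_{n}$ for every $n$-convex set $K$. If $\mathcal{D}=\varnothing$, then $v$ is the empty function, with empty image. -}

module Defs where

open import Data.Bool using () renaming (_≟_ to _≟ᵇ_)
open import Data.Fin using (Fin; zero; suc)
open import Data.Fin.Properties using (_≟_; any?; all?)
open import Data.Fin.Subset
open import Data.Fin.Subset.Properties
open import Data.Nat using (ℕ; suc; _+_; _∸_)
import Data.Nat as ℕ
open import Data.Nat.Properties using (+-suc; m+n∸m≡n; suc-injective)
open import Data.Product using (∃; ∃!; _×_; _,_; proj₁; proj₂)
open import Data.Sum using (_⊎_)
open import Data.Vec using (_∷_; tabulate; here; there)
open import Data.Vec.Properties using (≡-dec; lookup∘tabulate; []=⇒lookup; lookup⇒[]=)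
open import Data.Vec.Properties.WithK using ([]=-irrelevant)
open import Level using (0ℓ)
open import Relation.Binary using (Rel; Symmetric; Irreflexive)
import Relation.Binary as Binary
open import Relation.Binary.PropositionalEquality
open import Relation.Nullary using (Dec; yes; no; does; ¬_; ¬?; contradiction)
open import Relation.Nullary.Decidable
  using (map′; _×-dec_; _⊎-dec_; _→-dec_; decidable-stable; dec-true)
open import Relation.Unary using (Pred; Decidable)

private
  variable
    n : ℕ

infix 4 _≟ˢ_

_≟ˢ_ : Binary.DecidableEquality (Subset n)
_≟ˢ_ = ≡-dec _≟ᵇ_

allSubset? : {P : Pred (Subset n) 0ℓ} → Decidable P → Dec (∀ p → P p)
allSubset? P? = map′
  (λ ∄ p → decidable-stable (P? p) (λ ¬Pp → ∄ (p , ¬Pp)))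
  (λ ∀P (p , ¬Pp) → ¬Pp (∀P p))
  (¬? (anySubset? (λ p → ¬? (P? p))))

-- ｛ P? ｝ is the subset { x | P x }.
｛_｝ : {P : Pred (Fin n) 0ℓ} → Decidable P → Subset n
｛ P? ｝ = tabulate (λ x → does (P? x))

module _ {P : Pred (Fin n) 0ℓ} (P? : Decidable P) where

  ∈｛｝⁺ : ∀ {x} → P x → x ∈ ｛ P? ｝
  ∈｛｝⁺ {x} Px = lookup⇒[]= x _ (trans (lookup∘tabulate _ x) (dec-true (P? x) Px))

  ∈｛｝⁻ : ∀ {x} → x ∈ ｛ P? ｝ → P x
  ∈｛｝⁻ {x} x∈ with P? x | trans (sym (lookup∘tabulate (λ y → does (P? y)) x)) ([]=⇒lookup x∈)
  ... | yes Px | _  = Px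
  ... | no _   | ()

∣p∣≡0⇒p≡⊥ : (p : Subset n) → ∣ p ∣ ≡ 0 → p ≡ ⊥
∣p∣≡0⇒p≡⊥ p eq = Empty-unique λ (x , x∈p) →
  contradiction (subst (∣ p - x ∣ ℕ.<_) eq (x∈p⇒∣p-x∣<∣p∣ x∈p)) λ ()

∣p∣≡1⇒singleton : (p : Subset n) → ∣ p ∣ ≡ 1 → ∃ λ x → ⁅ x ⁆ ≡ p
∣p∣≡1⇒singleton (inside ∷ p) eq =
  zero , cong (inside ∷_) (sym (∣p∣≡0⇒p≡⊥ p (suc-injective eq)))
∣p∣≡1⇒singleton (outside ∷ p) eq with ∣p∣≡1⇒singleton p eq
... | x , ⁅x⁆≡p = suc x , cong (outside ∷_) ⁅x⁆≡p

⁅⁆-injective : {x y : Fin n} → ⁅ x ⁆ ≡ ⁅ y ⁆ → x ≡ y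
⁅⁆-injective {x = x} {y} eq = x∈⁅y⁆⇒x≡y y (subst (x ∈_) eq (x∈⁅x⁆ x))

∣⁅x⁆∪p∣≡1+∣p∣ : (x : Fin n) (p : Subset n) → x ∉ p → ∣ ⁅ x ⁆ ∪ p ∣ ≡ suc ∣ p ∣
∣⁅x⁆∪p∣≡1+∣p∣ zero    (inside  ∷ p) x∉p = contradiction here x∉p
∣⁅x⁆∪p∣≡1+∣p∣ zero    (outside ∷ p) x∉p = cong (λ q → suc ∣ q ∣) (∪-identityˡ p)
∣⁅x⁆∪p∣≡1+∣p∣ (suc x) (inside  ∷ p) x∉p =
  cong suc (∣⁅x⁆∪p∣≡1+∣p∣ x p (λ x∈p → x∉p (there x∈p)))
∣⁅x⁆∪p∣≡1+∣p∣ (suc x) (outside ∷ p) x∉p =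
  ∣⁅x⁆∪p∣≡1+∣p∣ x p (λ x∈p → x∉p (there x∈p))

-- Adjacency is decidable, as it is classically, so that the vertex sets below
-- are elements of Subset n.
record Graph (n : ℕ) : Set₁ where
  field
    Adj        : Rel (Fin n) 0ℓ
    adj?       : Binary.Decidable Adj
    adj-sym    : Symmetric Adj
    adj-irrefl : Irreflexive _≡_ Adj

module Convexity {n : ℕ} (G : Graph n) where

  open Graph G

  V : Subset n
  V = ⊤

  neighbours : Fin n → Subset n
  neighbours x = ｛ adj? x ｝

  degree : Fin n → ℕ
  degree x = ∣ neighbours x ∣

  N[_] : Fin n → Subset n
  N[ x ] = ⁅ x ⁆ ∪ neighbours x

  TrueTwinsFree : Set
  TrueTwinsFree = ¬ (∃ λ x → ∃ λ y → x ≢ y × N[ x ] ≡ N[ y ])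

  -- The intersection of the N[ y ] with y ∈ Y; this is V for Y = ⊥.
  N⟦_⟧ : Subset n → Subset n
  N⟦ Y ⟧ = ｛ (λ x → all? (λ y → (y ∈? Y) →-dec (x ∈? N[ y ]))) ｝

  Convex : Pred (Subset n) 0ℓ
  Convex K = (∃ λ Y → K ≡ N⟦ Y ⟧) ⊎ K ≡ ⊥

  convex? : Decidable Convex
  convex? K = anySubset? (λ Y → K ≟ˢ N⟦ Y ⟧) ⊎-dec (K ≟ˢ ⊥)

  hull : Subset n → Subset n
  hull X = ｛ (λ x → allSubset? (λ K → (convex? K ×-dec (X ⊆? K)) →-dec (x ∈? K))) ｝

  ex : Subset n → Subset n
  ex K = ｛ (λ x → (x ∈? K) ×-dec convex? (K - x)) ｝

  ConvexGeometry : Set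
  ConvexGeometry = ∀ K → Convex K → K ≡ hull (ex K)

  -- d(x) = n - 2, stated without truncated subtraction.
  quasiStar? : Decidable (λ x → degree x + 2 ≡ n)
  quasiStar? x = degree x + 2 ℕ.≟ n

  𝒟 : Subset n
  𝒟 = ｛ quasiStar? ｝

  ∣N[x]∣≡1+degree : ∀ x → ∣ N[ x ] ∣ ≡ suc (degree x)
  ∣N[x]∣≡1+degree x =
    ∣⁅x⁆∪p∣≡1+∣p∣ x (neighbours x) (λ x∈ → adj-irrefl refl (∈｛｝⁻ (adj? x) x∈))

  ∣∁N[x]∣≡1 : ∀ {x} → x ∈ 𝒟 → ∣ ∁ N[ x ] ∣ ≡ 1
  ∣∁N[x]∣≡1 {x} x∈𝒟 = begin
    ∣ ∁ N[ x ] ∣                     ≡⟨ ∣∁p∣≡n∸∣p∣ N[ x ] ⟩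
    n ∸ ∣ N[ x ] ∣                   ≡⟨ cong₂ _∸_ n≡ (∣N[x]∣≡1+degree x) ⟩
    suc (degree x) + 1 ∸ suc (degree x) ≡⟨ m+n∸m≡n (suc (degree x)) 1 ⟩
    1                                ∎
    where
    open ≡-Reasoning
    n≡ : n ≡ suc (degree x) + 1
    n≡ = trans (sym (∈｛｝⁻ quasiStar? x∈𝒟)) (+-suc (degree x) 1)

  missedVertex : ∀ {x} → x ∈ 𝒟 → ∃! _≡_ λ z → ⁅ z ⁆ ≡ ∁ N[ x ]
  missedVertex {x} x∈𝒟 with ∣p∣≡1⇒singleton (∁ N[ x ]) (∣∁N[x]∣≡1 x∈𝒟)
  ... | z , eq = z , eq , λ eq′ → ⁅⁆-injective (trans eq (sym eq′))

  v : ∃ (_∈ 𝒟) → Fin n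
  v (_ , x∈𝒟) = proj₁ (missedVertex x∈𝒟)

  inImage? : Decidable (λ z → ∃ λ d → v d ≡ z)
  inImage? z = map′
    (λ (x , x∈𝒟 , eq) → (x , x∈𝒟) , eq)
    (λ ((x , x∈𝒟) , eq) → x , x∈𝒟 , eq)
    (any? hits?)
    where
    hits? : Decidable (λ x → ∃ λ (x∈𝒟 : x ∈ 𝒟) → v (x , x∈𝒟) ≡ z)
    hits? x with x ∈? 𝒟
    ... | no x∉𝒟 = no λ (x∈𝒟 , _) → x∉𝒟 x∈𝒟
    ... | yes x∈𝒟 = map′ (x∈𝒟 ,_)
      (λ (x∈𝒟′ , eq) → subst (λ m → v (x , m) ≡ z) ([]=-irrelevant x∈𝒟′ x∈𝒟) eq)
      (v (x , x∈𝒟) ≟ z)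

  𝒯 : Subset n
  𝒯 = ｛ inImage? ｝

{-# OPTIONS --safe #-}

-- A vertex z lies outside N⟦ Y ⟧ exactly when it lies outside some N[ y ] with
-- y ∈ Y.  So if V - z = N⟦ Y ⟧, then V - z = N[ y ] for some y ∈ Y, which is
-- therefore a quasi-star missing z; conversely N[ x ] = V - v x for a quasi-star
-- x.  This gives (a), (b) and (c).  For (d), N⟦ N[ x ] ⟧ is the least convex set
-- containing x, and its only possible extreme point is x.  True twins x and y
-- have the same such set, so they coincide in a convex geometry.  Finally, if z
-- were the only extreme point of V, then V = N⟦ N[ z ] ⟧, and z would be adjacent
-- to the quasi-star that misses it.
module Submission where

open import Defs
open import Data.Fin using (Fin; zero; suc)
open import Data.Fin.Properties using (_≟_; all?; suc-injective; 0≢1+n)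
open import Data.Fin.Subset
  using (Subset; inside; outside; _∈_; _∉_; _⊆_; ⁅_⁆; ∁; _-_; _∪_; _∩_; ∣_∣; ⊥; Nonempty)
open import Data.Fin.Subset.Properties
open import Data.Nat using (ℕ; zero; suc; _≤_; _≥_; _+_; z≤n; s≤s)
open import Data.Nat.Properties using (≤-trans; ≤-antisym; +-comm)
open import Data.Product using (Σ; ∃; _×_; _,_; proj₁; proj₂)
open import Data.Sum using (inj₁; inj₂)
open import Data.Vec using ([]; _∷_; here; there)
open import Data.Vec.Properties.WithK using ([]=-irrelevant)
open import Function.Definitions using (Bijective)
open import Relation.Binary.PropositionalEquality
  using (_≡_; _≢_; refl; sym; trans; cong; subst; module ≡-Reasoning)
open import Relation.Nullary using (yes; no; contradiction)
open import Relation.Nullary.Decidable using (_×-dec_; _→-dec_; decidable-stable)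

private
  variable
    m n : ℕ

-- If `x` were in `p - x`, removing it again would shrink the set strictly, yet a second removal
-- changes nothing.
x∉p-x : (p : Subset n) (x : Fin n) → x ∉ p - x
x∉p-x p x x∈ = ⊂-irref (p─q─q≡p─q p ⁅ x ⁆) (x∈p⇒p-x⊂p x∈)

x∈p-y⇒x≢y : (p : Subset n) {x y : Fin n} → x ∈ p - y → x ≢ y
x∈p-y⇒x≢y p x∈ refl = x∉p-x p _ x∈

∃∈-≡ : {p : Subset n} {a b : ∃ (_∈ p)} → proj₁ a ≡ proj₁ b → a ≡ b
∃∈-≡ {a = x , x∈p} {.x , x∈p′} refl = cong (x ,_) ([]=-irrelevant x∈p x∈p′)

∃≢ : 2 ≤ n → (z : Fin n) → ∃ λ y → y ≢ z
∃≢ (s≤s (s≤s _)) zero    = suc zero , λ ()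
∃≢ (s≤s (s≤s _)) (suc z) = zero , λ ()

-- The map takes a membership proof because `v`, like the choice of a quasi-star for an extreme
-- point, is defined only on a subset. By induction on `p`: the image of a first element is deleted
-- from `q`, and injectivity keeps the other images in what remains.
injection⇒∣p∣≤∣q∣ : (p : Subset m) (q : Subset n) (f : ∀ {x} → x ∈ p → Fin n) →
  (∀ {x} (x∈p : x ∈ p) → f x∈p ∈ q) →
  (∀ {x y} (x∈p : x ∈ p) (y∈p : y ∈ p) → f x∈p ≡ f y∈p → x ≡ y) →
  ∣ p ∣ ≤ ∣ q ∣
injection⇒∣p∣≤∣q∣ []            q f f∈q f-inj = z≤n
injection⇒∣p∣≤∣q∣ (outside ∷ p) q f f∈q f-inj =
  injection⇒∣p∣≤∣q∣ p q (λ x∈ → f (there x∈)) (λ x∈ → f∈q (there x∈))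
    (λ x∈ y∈ eq → suc-injective (f-inj (there x∈) (there y∈) eq))
injection⇒∣p∣≤∣q∣ (inside  ∷ p) q f f∈q f-inj = ≤-trans
  (s≤s (injection⇒∣p∣≤∣q∣ p (q - f here) (λ x∈ → f (there x∈))
    (λ x∈ → x∈p∧x≢y⇒x∈p-y (f∈q (there x∈))
      (λ eq → 0≢1+n (f-inj here (there x∈) (sym eq))))
    (λ x∈ y∈ eq → suc-injective (f-inj (there x∈) (there y∈) eq))))
  (x∈p⇒∣p-x∣<∣p∣ (f∈q here))

module _ {n : ℕ} (G : Graph n) where

  open Graph G
  open Convexity G

  -- Closed neighbourhoods, least convex sets and extreme points

  x∈N[x] : ∀ x → x ∈ N[ x ]
  x∈N[x] x = p⊆p∪q (neighbours x) (x∈⁅x⁆ x)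

  ∈N-sym : ∀ {x y} → x ∈ N[ y ] → y ∈ N[ x ]
  ∈N-sym {x} {y} x∈ with x∈p∪q⁻ ⁅ y ⁆ (neighbours y) x∈
  ... | inj₁ x∈⁅y⁆ = subst (λ z → y ∈ N[ z ]) (sym (x∈⁅y⁆⇒x≡y y x∈⁅y⁆)) (x∈N[x] y)
  ... | inj₂ x∈y   =
    q⊆p∪q ⁅ x ⁆ (neighbours x) (∈｛｝⁺ (adj? x) (adj-sym (∈｛｝⁻ (adj? y) x∈y)))

  ∈N⟦⟧⁺ : ∀ {x} Y → (∀ y → y ∈ Y → x ∈ N[ y ]) → x ∈ N⟦ Y ⟧
  ∈N⟦⟧⁺ Y = ∈｛｝⁺ (λ x → all? (λ y → (y ∈? Y) →-dec (x ∈? N[ y ])))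

  ∈N⟦⟧⁻ : ∀ {x} Y → x ∈ N⟦ Y ⟧ → ∀ y → y ∈ Y → x ∈ N[ y ]
  ∈N⟦⟧⁻ Y = ∈｛｝⁻ (λ x → all? (λ y → (y ∈? Y) →-dec (x ∈? N[ y ])))

  ∉N⟦⟧⁻ : ∀ {x} Y → x ∉ N⟦ Y ⟧ → ∃ λ y → y ∈ Y × x ∉ N[ y ]
  -- The witness comes from a decidable search. Symmetry of adjacency lets the search use the single
  -- set `∁ N[ x ]` for all `y`.
  ∉N⟦⟧⁻ {x} Y x∉ with nonempty? (Y ∩ ∁ N[ x ])
  ... | yes (y , y∈) = let y∈Y , y∈∁ = x∈p∩q⁻ Y (∁ N[ x ]) y∈ in
    y , y∈Y , λ x∈ → x∈∁p⇒x∉p y∈∁ (∈N-sym x∈)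
  ... | no empty = contradiction
    (∈N⟦⟧⁺ Y λ y y∈Y → ∈N-sym (x∉∁p⇒x∈p λ y∈∁ → empty (y , x∈p∩q⁺ (y∈Y , y∈∁))))
    x∉

  hull-least : ∀ {X K} → Convex K → X ⊆ K → hull X ⊆ K
  hull-least {X} {K} convexK X⊆K x∈ = ∈｛｝⁻
    (λ x → allSubset? (λ K → (convex? K ×-dec (X ⊆? K)) →-dec (x ∈? K))) x∈ K (convexK , λ {_} → X⊆K)

  x∈N⟦N[x]⟧ : ∀ x → x ∈ N⟦ N[ x ] ⟧
  x∈N⟦N[x]⟧ x = ∈N⟦⟧⁺ N[ x ] λ y → ∈N-sym

  -- If `x ∈ N⟦ Y ⟧`, then `Y ⊆ N[ x ]` by symmetry, and `N⟦_⟧` reverses inclusions.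
  N⟦N[x]⟧-least : ∀ {K x} → Convex K → x ∈ K → N⟦ N[ x ] ⟧ ⊆ K
  N⟦N[x]⟧-least         (inj₂ refl)       x∈⊥ = contradiction x∈⊥ ∉⊥
  N⟦N[x]⟧-least {x = x} (inj₁ (Y , refl)) x∈ z∈ =
    ∈N⟦⟧⁺ Y λ y y∈Y → ∈N⟦⟧⁻ N[ x ] z∈ y (∈N-sym (∈N⟦⟧⁻ Y x∈ y y∈Y))

  ∈ex⁺ : ∀ {x} K → x ∈ K → Convex (K - x) → x ∈ ex K
  ∈ex⁺ K x∈K convex = ∈｛｝⁺ (λ x → (x ∈? K) ×-dec convex? (K - x)) (x∈K , convex)

  ∈ex⁻ : ∀ {x} K → x ∈ ex K → x ∈ K × Convex (K - x)
  ∈ex⁻ K = ∈｛｝⁻ (λ x → (x ∈? K) ×-dec convex? (K - x))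

  -- For `e ≢ x`, deleting `e` would leave a convex set that still contains `x`, against minimality.
  ex-N⟦N[x]⟧ : ∀ {x e} → e ∈ ex N⟦ N[ x ] ⟧ → x ≡ e
  ex-N⟦N[x]⟧ {x} {e} e∈ = decidable-stable (x ≟ e) λ x≢e →
    x∉p-x N⟦ N[ x ] ⟧ e (N⟦N[x]⟧-least {x = x} (proj₂ (∈ex⁻ N⟦ N[ x ] ⟧ e∈))
      (x∈p∧x≢y⇒x∈p-y (x∈N⟦N[x]⟧ x) x≢e) (proj₁ (∈ex⁻ N⟦ N[ x ] ⟧ e∈)))

  -- Since `⊥` is convex, the hull of an empty set of extreme points is empty and cannot be `K`.
  geometry⇒ex-nonempty : ConvexGeometry → ∀ {K x} → Convex K → x ∈ K → Nonempty (ex K)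
  geometry⇒ex-nonempty geom {K} {x} convexK x∈K with nonempty? (ex K)
  ... | yes e∈ = e∈
  ... | no empty = contradiction
    (hull-least {ex K} (inj₂ refl) (λ e∈ → contradiction (_ , e∈) empty)
      (subst (x ∈_) (geom K convexK) x∈K))
    ∉⊥

  geometry⇒trueTwinsFree : ConvexGeometry → TrueTwinsFree
  geometry⇒trueTwinsFree geom (x , y , x≢y , N[x]≡N[y]) =
    let e , e∈ = geometry⇒ex-nonempty geom {N⟦ N[ x ] ⟧} (inj₁ (N[ x ] , refl)) (x∈N⟦N[x]⟧ x)
    in x≢y (trans (ex-N⟦N[x]⟧ e∈)
      (sym (ex-N⟦N[x]⟧ (subst (λ N → e ∈ ex N⟦ N ⟧) N[x]≡N[y] e∈))))

  -- Quasi-stars and the vertices they miss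

  v-spec : ∀ d → ⁅ v d ⁆ ≡ ∁ N[ proj₁ d ]
  v-spec (_ , x∈𝒟) = proj₁ (proj₂ (missedVertex x∈𝒟))

  v-cong : ∀ d d′ → proj₁ d ≡ proj₁ d′ → v d ≡ v d′
  v-cong d d′ eq =
    ⁅⁆-injective (trans (v-spec d) (trans (cong (λ x → ∁ N[ x ]) eq) (sym (v-spec d′))))

  v∉N[x] : ∀ d → v d ∉ N[ proj₁ d ]
  v∉N[x] d = x∈∁p⇒x∉p (subst (v d ∈_) (v-spec d) (x∈⁅x⁆ (v d)))

  ∉N[x]⇒≡v : ∀ d {z} → z ∉ N[ proj₁ d ] → z ≡ v d
  ∉N[x]⇒≡v d {z} z∉ = x∈⁅y⁆⇒x≡y (v d) (subst (z ∈_) (sym (v-spec d)) (x∉p⇒x∈∁p z∉))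

  misses-one⇒∈𝒟 : ∀ {x z} → z ∉ N[ x ] → (∀ {y} → y ≢ z → y ∈ N[ x ]) → x ∈ 𝒟
  misses-one⇒∈𝒟 {x} {z} z∉ ≢z⇒∈ = ∈｛｝⁺ quasiStar? (begin
    degree x + 2         ≡⟨ +-comm (degree x) 2 ⟩
    suc (suc (degree x)) ≡⟨ cong suc (∣N[x]∣≡1+degree x) ⟨
    suc ∣ N[ x ] ∣       ≡⟨ ∣⁅x⁆∪p∣≡1+∣p∣ z N[ x ] z∉ ⟨
    ∣ ⁅ z ⁆ ∪ N[ x ] ∣   ≡⟨ cong ∣_∣ (⊆-antisym ⊆⊤ (λ {y} _ → covers y)) ⟩
    ∣ V ∣                ≡⟨ ∣⊤∣≡n n ⟩
    n                    ∎)
    where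
    open ≡-Reasoning
    covers : ∀ y → y ∈ ⁅ z ⁆ ∪ N[ x ]
    covers y with y ≟ z
    ... | yes refl = p⊆p∪q N[ x ] (x∈⁅x⁆ z)
    ... | no y≢z   = q⊆p∪q ⁅ z ⁆ N[ x ] (≢z⇒∈ y≢z)

  v∈exV : ∀ d → v d ∈ ex V
  v∈exV d@(x , _) = ∈ex⁺ V ∈⊤ (inj₁ (⁅ x ⁆ , ⊆-antisym V-v⊆ ⊆V-v))
    where
    V-v⊆ : V - v d ⊆ N⟦ ⁅ x ⁆ ⟧
    V-v⊆ {z} z∈ = ∈N⟦⟧⁺ ⁅ x ⁆ λ y y∈ → subst (λ w → z ∈ N[ w ]) (sym (x∈⁅y⁆⇒x≡y x y∈))
      (decidable-stable (z ∈? N[ x ]) λ z∉ → x∈p-y⇒x≢y V z∈ (∉N[x]⇒≡v d z∉))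

    ⊆V-v : N⟦ ⁅ x ⁆ ⟧ ⊆ V - v d
    ⊆V-v z∈ = x∈p∧x≢y⇒x∈p-y ∈⊤
      λ z≡v → v∉N[x] d (subst (_∈ N[ x ]) z≡v (∈N⟦⟧⁻ ⁅ x ⁆ z∈ x (x∈⁅x⁆ x)))

  exV⇒v : 2 ≤ n → ∀ {z} → z ∈ ex V → ∃ λ d → v d ≡ z
  exV⇒v 2≤n {z} z∈ with proj₂ (∈ex⁻ V z∈)
  -- A second vertex is essential here: for `n = 1` the set `V - z` is empty, hence convex, but
  -- there is no quasi-star.
  ... | inj₂ V-z≡⊥ = let y , y≢z = ∃≢ 2≤n z in
    contradiction (subst (y ∈_) V-z≡⊥ (x∈p∧x≢y⇒x∈p-y ∈⊤ y≢z)) ∉⊥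
  ... | inj₁ (Y , V-z≡) = (y , y∈𝒟) , sym (∉N[x]⇒≡v (y , y∈𝒟) z∉N[y])
    where
    -- As `z` is not in `V - z`, which is `N⟦ Y ⟧`, some `y ∈ Y` misses `z`. Its neighbourhood
    -- contains `N⟦ Y ⟧`, so it misses nothing else.
    missing = ∉N⟦⟧⁻ {z} Y (λ z∈N → x∉p-x V z (subst (z ∈_) (sym V-z≡) z∈N))
    y      = proj₁ missing
    y∈Y    = proj₁ (proj₂ missing)
    z∉N[y] = proj₂ (proj₂ missing)
    y∈𝒟 : y ∈ 𝒟
    y∈𝒟 = misses-one⇒∈𝒟 z∉N[y] λ {w} w≢z →
      ∈N⟦⟧⁻ Y (subst (w ∈_) V-z≡ (x∈p∧x≢y⇒x∈p-y ∈⊤ w≢z)) y y∈Y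

  -- Comparing quasi-stars with the extreme points of `V`

  𝒯≡exV : 2 ≤ n → 𝒯 ≡ ex V
  𝒯≡exV 2≤n = ⊆-antisym
    (λ z∈ → let d , vd≡z = ∈｛｝⁻ inImage? z∈ in subst (_∈ ex V) vd≡z (v∈exV d))
    (λ z∈ → ∈｛｝⁺ inImage? (exV⇒v 2≤n z∈))

  -- Choosing for each extreme point a quasi-star that misses it is injective, because `v` recovers
  -- the point.
  ∣exV∣≤∣𝒟∣ : 2 ≤ n → ∣ ex V ∣ ≤ ∣ 𝒟 ∣
  ∣exV∣≤∣𝒟∣ 2≤n = injection⇒∣p∣≤∣q∣ (ex V) 𝒟
    (λ z∈ → proj₁ (proj₁ (exV⇒v 2≤n z∈)))
    (λ z∈ → proj₂ (proj₁ (exV⇒v 2≤n z∈)))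
    (λ y∈ z∈ eq → trans (sym (proj₂ (exV⇒v 2≤n y∈)))
      (trans (v-cong (proj₁ (exV⇒v 2≤n y∈)) (proj₁ (exV⇒v 2≤n z∈)) eq) (proj₂ (exV⇒v 2≤n z∈))))

  V≡N⟦𝒟⟧∪exV : V ≡ N⟦ 𝒟 ⟧ ∪ ex V
  V≡N⟦𝒟⟧∪exV = ⊆-antisym (λ {z} _ → covers z) ⊆⊤
    where
    covers : ∀ z → z ∈ N⟦ 𝒟 ⟧ ∪ ex V
    covers z with z ∈? N⟦ 𝒟 ⟧
    ... | yes z∈ = p⊆p∪q (ex V) z∈
    ... | no z∉  = let x , x∈𝒟 , z∉N[x] = ∉N⟦⟧⁻ 𝒟 z∉ in
      q⊆p∪q N⟦ 𝒟 ⟧ (ex V)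
        (subst (_∈ ex V) (sym (∉N[x]⇒≡v (x , x∈𝒟) z∉N[x])) (v∈exV (x , x∈𝒟)))

  N⟦𝒟⟧∩exV≡⊥ : 2 ≤ n → N⟦ 𝒟 ⟧ ∩ ex V ≡ ⊥
  N⟦𝒟⟧∩exV≡⊥ 2≤n = Empty-unique λ (z , z∈) →
    let z∈N , z∈ex = x∈p∩q⁻ N⟦ 𝒟 ⟧ (ex V) z∈
        (x , x∈𝒟) , vd≡z = exV⇒v 2≤n z∈ex
    in v∉N[x] (x , x∈𝒟) (subst (_∈ N[ x ]) (sym vd≡z) (∈N⟦⟧⁻ 𝒟 z∈N x x∈𝒟))

  -- A quasi-star's closed neighbourhood is determined by the one vertex it misses, so two
  -- quasi-stars with the same value of `v` would be true twins.
  v-injective : TrueTwinsFree → ∀ d d′ → v d ≡ v d′ → proj₁ d ≡ proj₁ d′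
  v-injective twinsFree d d′ eq = decidable-stable (proj₁ d ≟ proj₁ d′) λ x≢y →
    twinsFree (_ , _ , x≢y , ⊆-antisym (N⊆ d d′ eq) (N⊆ d′ d (sym eq)))
    where
    N⊆ : ∀ d d′ → v d ≡ v d′ → N[ proj₁ d ] ⊆ N[ proj₁ d′ ]
    N⊆ d d′ eq {z} z∈ = decidable-stable (z ∈? N[ proj₁ d′ ]) λ z∉ →
      v∉N[x] d (subst (_∈ N[ proj₁ d ]) (trans (∉N[x]⇒≡v d′ z∉) (sym eq)) z∈)

  v-bijective : 2 ≤ n → TrueTwinsFree →
    Bijective _≡_ (_≡_ {A = ∃ (_∈ ex V)}) (λ d → v d , v∈exV d)
  v-bijective 2≤n twinsFree =
    (λ {d} {d′} eq → ∃∈-≡ (v-injective twinsFree d d′ (cong proj₁ eq))) ,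
    (λ (z , z∈) → let d , vd≡z = exV⇒v 2≤n z∈ in
      d , λ { refl → ∃∈-≡ vd≡z })

  ∣𝒟∣≤∣exV∣ : TrueTwinsFree → ∣ 𝒟 ∣ ≤ ∣ ex V ∣
  ∣𝒟∣≤∣exV∣ twinsFree = injection⇒∣p∣≤∣q∣ 𝒟 (ex V)
    (λ x∈ → v (_ , x∈)) (λ x∈ → v∈exV (_ , x∈))
    (λ x∈ y∈ → v-injective twinsFree (_ , x∈) (_ , y∈))

  -- At least two extreme points in a convex geometry

  V-convex : Convex V
  V-convex = inj₁ (⊥ , ⊆-antisym (λ _ → ∈N⟦⟧⁺ ⊥ λ y y∈⊥ → contradiction y∈⊥ ∉⊥) ⊆⊤)

  geometry⇒exV≢⁅⁆ : 2 ≤ n → ConvexGeometry → ∀ z → ⁅ z ⁆ ≢ ex V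
  geometry⇒exV≢⁅⁆ 2≤n geom z ⁅z⁆≡exV =
    let (x , x∈𝒟) , vd≡z = exV⇒v 2≤n (subst (z ∈_) ⁅z⁆≡exV (x∈⁅x⁆ z))
        exV⊆ = λ {e} e∈ → subst (_∈ N⟦ N[ z ] ⟧)
          (sym (x∈⁅y⁆⇒x≡y z (subst (e ∈_) (sym ⁅z⁆≡exV) e∈))) (x∈N⟦N[x]⟧ z)
        -- `V` is the hull of `ex V`, so every vertex, including the quasi-star `x` that misses `z`,
        -- lies in this convex set containing `z`.
        x∈N⟦N[z]⟧ = hull-least {ex V} (inj₁ (N[ z ] , refl)) exV⊆
          (subst (x ∈_) (geom V V-convex) ∈⊤)
    in v∉N[x] (x , x∈𝒟) (subst (_∈ N[ x ]) (sym vd≡z)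
      (∈N-sym (∈N⟦⟧⁻ N[ z ] x∈N⟦N[z]⟧ z (x∈N[x] z))))

  geometry⇒2≤∣exV∣ : 2 ≤ n → ConvexGeometry → 2 ≤ ∣ ex V ∣
  -- Matching on `2≤n` shows `n` to be a successor, so that `zero` is a vertex of `V`.
  geometry⇒2≤∣exV∣ 2≤n@(s≤s _) geom with ∣ ex V ∣ in eq
  ... | zero = let e , e∈ = geometry⇒ex-nonempty geom {V} V-convex (∈⊤ {x = zero}) in
    contradiction (subst (e ∈_) (∣p∣≡0⇒p≡⊥ (ex V) eq) e∈) ∉⊥
  ... | suc zero = let z , ⁅z⁆≡exV = ∣p∣≡1⇒singleton (ex V) eq in
    contradiction ⁅z⁆≡exV (geometry⇒exV≢⁅⁆ 2≤n geom z)
  ... | suc (suc _) = s≤s (s≤s z≤n)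

theorem23 : ∀ {n : ℕ} → 2 ≤ n → (G : Graph n) → let open Convexity G in
    (𝒯 ≡ ex V × ∣ 𝒟 ∣ ≥ ∣ ex V ∣)
    × (V ≡ N⟦ 𝒟 ⟧ ∪ ex V × N⟦ 𝒟 ⟧ ∩ ex V ≡ ⊥)
    × (TrueTwinsFree →
    Σ (∀ d → v d ∈ ex V) λ v∈ex → Bijective _≡_ (_≡_ {A = ∃ (_∈ ex V)}) (λ d → v d , v∈ex d))
    × (ConvexGeometry → ∣ ex V ∣ ≡ ∣ 𝒟 ∣ × ∣ 𝒟 ∣ ≥ 2)
theorem23 2≤n G =
  (𝒯≡exV G 2≤n , ∣exV∣≤∣𝒟∣ G 2≤n) ,
  (V≡N⟦𝒟⟧∪exV G , N⟦𝒟⟧∩exV≡⊥ G 2≤n) ,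
  (λ twinsFree → v∈exV G , v-bijective G 2≤n twinsFree) ,
  λ geom →
    ≤-antisym (∣exV∣≤∣𝒟∣ G 2≤n) (∣𝒟∣≤∣exV∣ G (geometry⇒trueTwinsFree G geom)) ,
    ≤-trans (geometry⇒2≤∣exV∣ G 2≤n geom) (∣exV∣≤∣𝒟∣ G 2≤n)
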